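{- Let $F=\{e_1,\ldots,e_p\}\subseteq E(K_n)$ be a set of $p\ge 1$ distinct edges of the complete graph $K_n$, and assume that $G=K_n-F$ is connected. Let $B$ be an oriented incidence matrix of $F$ and let $Q=B^TB$ be the edge-defect matrix. For two distinct vertices $x,y\in V(G)$, put $\eta_{xy}=B^T(e_x-e_y)\in\mathbb{R}^p$. Then $$R_G(x,y)=\frac{2}{n}+\frac{1}{n}\,\eta_{xy}^T\,(nI_p-Q)^{ -1}\,\eta_{xy}.$$
   Context: $K_n$ is the complete graph on $n$ vertices and $K_n-F$ is the graph on the same $n$ vertices obtained by deleting the edges in $F$. For a vertex $x$, $e_x\in\mathbb{R}^n$ denotes the standard basis vector indexed by $x$ (not to be confused with the edges $e_\alpha$). For each deleted edge $e_\alpha=\{u_\alpha,v_\alpha\}$ choose an arbitrary orientation and put $b_\alpha=e_{u_\alpha}-e_{v_\alpha}\in\mathbb{R}^n$; the incidence matrix of $F$ is the $n\times p$ matrix $B=[\,b_1\ \cdots\ b_p\,]$, and the edge-defect matrix of $F$ is the $p\times p$ matrix $Q=B^TB$. For a connected graph $G$ with Laplacian matrix $L(G)=D(G)-A(G)$ (degree matrix minus adjacency matrix), the effective resistance between distinct vertices $x,y$ is $R_G(x,y)=(e_x-e_y)^TL(G)^+(e_x-e_y)$, where $L(G)^+$ is the Moore--Penrose inverse. -}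

module Defs where

open import Algebra.Apartness.Bundles using (HeytingField; HeytingCommutativeRing)
open import Algebra.Bundles using (CommutativeRing; Semiring)
import Algebra.Definitions
import Algebra.Definitions.RawSemiring
open import Data.Bool.Base using (if_then_else_)
open import Data.Fin.Base using (Fin)
open import Data.Fin.Properties using (_≟_; any?)
open import Data.List.Base using (allFin; filter; length)
open import Data.Nat.Base using (ℕ; NonZero)
open import Data.Product.Base using (∃; _,_; _×_; proj₁)
open import Data.Sum.Base using (_⊎_; inj₁; inj₂)
open import Data.Vec.Functional using (Vector)
open import Level using (Level; 0ℓ; _⊔_)
open import Relation.Binary.Construct.Closure.ReflexiveTransitive using (Star)
open import Relation.Binary.Core using (Rel)
open import Relation.Binary.Definitions using (Decidable; Irreflexive; Symmetric)
open import Relation.Binary.PropositionalEquality.Core using (_≡_; _≢_; ≢-sym)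
open import Relation.Nullary.Decidable.Core using (Dec; does; ¬?; _×-dec_; _⊎-dec_)
open import Relation.Nullary.Negation.Core using (¬_)

------------------------------------------------------------------------
-- Finite simple graphs

record Graph (n : ℕ) : Set₁ where
  infix 4 _~_ _~?_
  field
    _~_      : Rel (Fin n) 0ℓ
    _~?_     : Decidable _~_
    ~-sym    : Symmetric _~_
    ~-irrefl : Irreflexive _≡_ _~_

  Connected : Set
  Connected = ∀ u v → Star _~_ u v

  degree : Fin n → ℕ
  degree u = length (filter (u ~?_) (allFin n))

complete : ∀ n → Graph n
complete n = record
  { _~_      = _≢_
  ; _~?_     = λ u v → ¬? (u ≟ v)
  ; ~-sym    = ≢-sym
  ; ~-irrefl = λ u≡v u≢v → u≢v u≡v
  }

-- An edge together with an orientation.  Everything that should depend on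
-- the underlying edge only goes through Joins, which ignores the
-- orientation.
record Edge {n} (G : Graph n) : Set where
  open Graph G
  field
    src tgt : Fin n
    src~tgt : src ~ tgt

open Edge public

module _ {n} {G : Graph n} where

  Joins : Edge G → Fin n → Fin n → Set
  Joins e u v = (src e ≡ u × tgt e ≡ v) ⊎ (src e ≡ v × tgt e ≡ u)

  joins? : ∀ e u v → Dec (Joins e u v)
  joins? e u v =
    (src e ≟ u ×-dec tgt e ≟ v) ⊎-dec (src e ≟ v ×-dec tgt e ≟ u)

  Joins-sym : ∀ e {u v} → Joins e u v → Joins e v u
  Joins-sym e (inj₁ p) = inj₂ p
  Joins-sym e (inj₂ p) = inj₁ p

  infix 4 _≈ᵉ_

  _≈ᵉ_ : Rel (Edge G) 0ℓ
  e ≈ᵉ f = Joins e (src f) (tgt f)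

infixl 6 _─_

_─_ : ∀ {n p} (G : Graph n) → (Fin p → Edge G) → Graph n
G ─ F = record
  { _~_      = λ u v → u ~ v × ¬ (∃ λ α → Joins (F α) u v)
  ; _~?_     = λ u v → (u ~? v) ×-dec ¬? (any? λ α → joins? (F α) u v)
  ; ~-sym    = λ (u~v , ∉F) →
                 ~-sym u~v , λ (α , j) → ∉F (α , Joins-sym (F α) j)
  ; ~-irrefl = λ u≡v (u~v , _) → ~-irrefl u≡v u~v
  }
  where open Graph G

------------------------------------------------------------------------
-- Linear algebra over a field of characteristic zero, of which the real
-- numbers are an instance

module _ {c ℓ₁ ℓ₂} (K : HeytingField c ℓ₁ ℓ₂) where

  open HeytingField K

  semiring : Semiring c ℓ₁
  semiring = CommutativeRing.semiring
    (HeytingCommutativeRing.commutativeRing heytingCommutativeRing)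

  open Algebra.Definitions.RawSemiring (Semiring.rawSemiring semiring)
    using () renaming (_×_ to _×ᴷ_)

  CharacteristicZero : Set ℓ₂
  CharacteristicZero = ∀ n → .{{NonZero n}} → (n ×ᴷ 1#) # 0#

module Field {c ℓ₁ ℓ₂}
  (K : HeytingField c ℓ₁ ℓ₂) (char0 : CharacteristicZero K) where

  open HeytingField K public
  open Algebra.Definitions.RawSemiring (Semiring.rawSemiring (semiring K))
    using (sum) renaming (_×_ to _×ᴷ_)

  fromℕ : ℕ → Carrier
  fromℕ n = n ×ᴷ 1#

  -- The library supplies the inverse of fromℕ n - 0#, which is ≈ to fromℕ n.
  1/_ : (n : ℕ) → .{{NonZero n}} → Carrier
  1/ n = proj₁ (#⇒invertible (char0 n))

  infixl 7 _/ᴺ_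

  _/ᴺ_ : (m n : ℕ) → .{{NonZero n}} → Carrier
  m /ᴺ n = fromℕ m * (1/ n)

  indicator : ∀ {a} {A : Set a} → Dec A → Carrier
  indicator a? = if does a? then 1# else 0#

  private variable
    l m n p : ℕ

  Matrix : ℕ → ℕ → Set c
  Matrix m n = Vector (Vector Carrier n) m

  infix  4 _≈ᴹ_
  infixl 6 _-ᴹ_ _-ᵛ_
  infixl 7 _*ᴹ_ _∙_
  infixr 7 _*ᵛ_ _*ₗ_
  infix  9 _ᵀ

  _≈ᴹ_ : Rel (Matrix m n) ℓ₁
  A ≈ᴹ B = ∀ i j → A i j ≈ B i j

  _-ᵛ_ : Vector Carrier n → Vector Carrier n → Vector Carrier n
  (u -ᵛ v) i = u i - v i

  _∙_ : Vector Carrier n → Vector Carrier n → Carrier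
  u ∙ v = sum λ i → u i * v i

  _ᵀ : Matrix m n → Matrix n m
  (A ᵀ) i j = A j i

  _-ᴹ_ : Matrix m n → Matrix m n → Matrix m n
  (A -ᴹ B) i j = A i j - B i j

  _*ₗ_ : Carrier → Matrix m n → Matrix m n
  (a *ₗ A) i j = a * A i j

  _*ᵛ_ : Matrix m n → Vector Carrier n → Vector Carrier m
  (A *ᵛ v) i = A i ∙ v

  _*ᴹ_ : Matrix l m → Matrix m n → Matrix l n
  (A *ᴹ B) i j = A i ∙ (B ᵀ) j

  basis : Fin n → Vector Carrier n
  basis x i = indicator (x ≟ i)

  I : Matrix n n
  I = basis

  Invertible : Matrix n n → Set (c ⊔ ℓ₁)
  Invertible = Algebra.Definitions.Invertible _≈ᴹ_ I _*ᴹ_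

  inverse : {A : Matrix n n} → Invertible A → Matrix n n
  inverse = proj₁

  record MoorePenroseInverse (A : Matrix m n) : Set (c ⊔ ℓ₁) where
    field
      A⁺       : Matrix n m
      AA⁺A≈A   : A *ᴹ A⁺ *ᴹ A ≈ᴹ A
      A⁺AA⁺≈A⁺ : A⁺ *ᴹ A *ᴹ A⁺ ≈ᴹ A⁺
      AA⁺-sym  : (A *ᴹ A⁺) ᵀ ≈ᴹ A *ᴹ A⁺
      A⁺A-sym  : (A⁺ *ᴹ A) ᵀ ≈ᴹ A⁺ *ᴹ A

  ----------------------------------------------------------------------
  -- Matrices of graphs

  adjacencyMatrix : Graph n → Matrix n n
  adjacencyMatrix G u v = indicator (u ~? v)
    where open Graph G

  degreeMatrix : Graph n → Matrix n n
  degreeMatrix G u v = if does (u ≟ v) then fromℕ (degree u) else 0#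
    where open Graph G

  laplacian : Graph n → Matrix n n
  laplacian G = degreeMatrix G -ᴹ adjacencyMatrix G

  incidenceMatrix : {G : Graph n} → (Fin p → Edge G) → Matrix n p
  incidenceMatrix F = (λ α → basis (src (F α)) -ᵛ basis (tgt (F α))) ᵀ

  edgeDefectMatrix : {G : Graph n} → (Fin p → Edge G) → Matrix p p
  edgeDefectMatrix F = incidenceMatrix F ᵀ *ᴹ incidenceMatrix F

  effectiveResistance : (G : Graph n) → MoorePenroseInverse (laplacian G) →
                        Fin n → Fin n → Carrier
  effectiveResistance G L⁺ x y =
    (basis x -ᵛ basis y) ∙ (MoorePenroseInverse.A⁺ L⁺ *ᵛ (basis x -ᵛ basis y))

{-# OPTIONS --safe #-}

-- Let L be the Laplacian of G = Kₙ - F and J the all-ones matrix, so that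
-- B Bᵀ = n I - J - L.  If L w = e_x - e_y and w has mean zero, then
-- (n I - Q) Bᵀ w = Bᵀ (n I - B Bᵀ) w = Bᵀ L w = η, hence
-- ηᵀ (n I - Q)⁻¹ η = ηᵀ Bᵀ w = (e_x - e_y)ᵀ B Bᵀ w = n (e_x - e_y)ᵀ w - 2,
-- while R_G(x, y) = wᵀ L L⁺ L w = (e_x - e_y)ᵀ w.
--
-- The remaining point is that L w = f is solvable whenever f has sum zero.  The
-- field is not ordered, so positive definiteness is not available; instead
-- vertices are eliminated one at a time by star-mesh transforms.  These keep the
-- edge weights natural numbers and the graph connected, so each pivot is a
-- positive natural number, which is invertible in characteristic zero.

module Submission where

open import Defs
open import Algebra.Apartness.Bundles using (HeytingField; HeytingCommutativeRing)
open import Algebra.Bundles using (CommutativeMonoid; CommutativeRing; RawRing)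
import Algebra.Properties.AbelianGroup
import Algebra.Properties.CommutativeSemigroup
import Algebra.Properties.Ring
import Algebra.Properties.Semiring.Mult
import Algebra.Properties.Semiring.Sum
import Algebra.Solver.Ring
open import Algebra.Solver.Ring.AlmostCommutativeRing using (AlmostCommutativeRing; fromCommutativeRing; _-Raw-AlmostCommutative⟶_; Induced-equivalence)
open import Data.Bool.Base using (true; false; if_then_else_)
open import Data.Fin.Base using (Fin; zero; suc)
open import Data.Fin.Properties using (_≟_; any?)
open import Data.List.Base using (filter; length; tabulate)
import Data.Maybe.Base as Maybe
import Data.Nat.Base as ℕ
open import Data.Nat.Base using (ℕ; zero; suc; NonZero; _≤_; _<_; >-nonZero)
import Data.Nat.Properties as ℕ
open import Data.Product.Base using (∃; _×_; _,_; proj₁; proj₂)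
open import Data.Sum.Base using (inj₁; inj₂)
open import Data.Vec.Functional using (Vector; foldr)
open import Function.Base using (_∘_; id)
open import Function.Bundles using (mk⇔)
open import Function.Definitions using (Injective)
open import Relation.Binary.Definitions using (WeaklyDecidable)
open import Relation.Binary.Construct.Closure.ReflexiveTransitive using (Star; ε; _◅_; gmap)
open import Relation.Binary.PropositionalEquality.Core as ≡ using (_≡_; _≢_)
import Relation.Binary.Reasoning.Setoid
open import Relation.Nullary.Decidable using (Dec; does; dec⇒maybe; yes; no; dec-true; dec-false; does-⇔)
open import Relation.Nullary.Negation.Core using (¬_; contradiction)
open import Relation.Unary using (Decidable)

-- Weighted graphs and the elimination of a vertex.

Weights : ℕ → Set
Weights n = Fin n → Fin n → ℕ

Linked : ∀ {n} → Weights n → Fin n → Fin n → Set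
Linked w u v = 0 < w u v

total : ∀ {n} → (Fin n → ℕ) → ℕ
total = foldr ℕ._+_ 0

≤-total : ∀ {n} (a : Fin n → ℕ) i → a i ≤ total a
≤-total a zero    = ℕ.m≤m+n _ _
≤-total a (suc i) = ℕ.≤-trans (≤-total (a ∘ suc) i) (ℕ.m≤n+m _ (a zero))

module _ {n} (w : Weights (suc n)) where

  private
    d : ℕ
    d = total (w zero ∘ suc)

  -- The star-mesh transform, scaled by the weighted degree of the removed
  -- vertex so that the weights stay natural numbers.
  starMesh : Weights n
  starMesh u v =
    w (suc u) zero ℕ.* w zero (suc v) ℕ.+ d ℕ.* w (suc u) (suc v)

  starMesh-sym : (∀ u v → w u v ≡ w v u) → ∀ u v → starMesh u v ≡ starMesh v u
  starMesh-sym w-sym u v = ≡.cong₂ ℕ._+_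
    (≡.trans (≡.cong₂ ℕ._*_ (w-sym (suc u) zero) (w-sym zero (suc v)))
             (ℕ.*-comm (w zero (suc u)) (w (suc v) zero)))
    (≡.cong (d ℕ.*_) (w-sym (suc u) (suc v)))

  -- The path must step off `zero` at some point, and that step has positive weight. Loops at `zero`
  -- are skipped first: star-mesh transforms do create diagonal weights, and `d` does not count
  -- them.
  degree-positive : ∀ {v} → Star (Linked w) zero (suc v) → 0 < d
  degree-positive (_◅_ {j = zero}  _ p) = degree-positive p
  degree-positive (_◅_ {j = suc k} r _) =
    ℕ.<-≤-trans r (≤-total (w zero ∘ suc) k)

  module _ (d>0 : 0 < d) where

    -- A step between surviving vertices persists through the summand `d * w`, which is positive
    -- because `d` is. A detour through `zero` becomes a single step through the product summand.
    starMesh-path : ∀ {u v} → Star (Linked w) (suc u) (suc v) →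
                    Star (Linked starMesh) u v
    -- Here the path is currently at `zero`; the extra argument remembers the surviving vertex from
    -- which it entered.
    starMesh-path-via : ∀ {u v} → Linked w (suc u) zero →
                        Star (Linked w) zero (suc v) → Star (Linked starMesh) u v

    starMesh-path ε = ε
    starMesh-path (_◅_ {j = zero}  r p) = starMesh-path-via r p
    starMesh-path (_◅_ {j = suc k} r p) =
      ℕ.<-≤-trans (ℕ.*-mono-< d>0 r) (ℕ.m≤n+m _ _) ◅ starMesh-path p

    starMesh-path-via r (_◅_ {j = zero}  _ p) = starMesh-path-via r p
    starMesh-path-via r (_◅_ {j = suc k} s p) =
      ℕ.<-≤-trans (ℕ.*-mono-< r s) (ℕ.m≤m+n _ _) ◅ starMesh-path p

-- The ring solver with integer coefficients.  An integer is a formal difference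
-- (m , n) of natural numbers; ⟦_⟧ sends 0 and 1 definitionally to 0# and 1#, so
-- that these constants can occur in the equations to be solved.
module IntegerCoefficients {c ℓ} (R : CommutativeRing c ℓ) where

  open CommutativeRing R hiding (semiring; zero)
  open Algebra.Properties.Ring ring
    using (x[y-z]≈xy-xz; [y-z]x≈yx-zx; x∙y⁻¹≈ε⇒x≈y)
  open Algebra.Properties.AbelianGroup +-abelianGroup
    using () renaming (⁻¹-∙-comm to -‿+-comm; ⁻¹-anti-homo‿- to -‿anti-homo-)
  open Algebra.Properties.CommutativeSemigroup
    (CommutativeMonoid.commutativeSemigroup +-commutativeMonoid) using (interchange)
  open Algebra.Properties.Semiring.Mult (CommutativeRing.semiring R) using (×-homo-+; ×1-homo-*)
    renaming (_×_ to _×ᴿ_)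
  open Relation.Binary.Reasoning.Setoid setoid

  private
    coefficients : RawRing _ _
    coefficients = record
      { Carrier = ℕ × ℕ
      ; _≈_     = _≡_
      ; _+_     = λ (a , b) (c , d) → a ℕ.+ c , b ℕ.+ d
      ; _*_     = λ (a , b) (c , d) → a ℕ.* c ℕ.+ b ℕ.* d , b ℕ.* c ℕ.+ a ℕ.* d
      ; -_      = λ (a , b) → b , a
      ; 0#      = 0 , 0
      ; 1#      = 1 , 0
      }

    ι : ℕ → Carrier
    ι n = n ×ᴿ 1#

    ⟦_⟧ : ℕ × ℕ → Carrier
    ⟦ 0 , 0 ⟧ = 0#
    ⟦ 1 , 0 ⟧ = 1#
    ⟦ a , b ⟧ = ι a - ι b

    x≈x-0# : ∀ x → x ≈ x - 0#
    x≈x-0# x = begin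
      x              ≈⟨ +-identityʳ x ⟨
      x + 0#         ≈⟨ +-congˡ (-‿inverseʳ 0#) ⟨
      x + (0# - 0#)  ≈⟨ +-congˡ (+-identityˡ (- 0#)) ⟩
      x - 0#         ∎

    -- The special clauses of `⟦_⟧` alter its value only up to `≈`, so the homomorphism laws can be
    -- checked on the uniform formula.
    ⟦⟧-difference : ∀ a b → ⟦ a , b ⟧ ≈ ι a - ι b
    ⟦⟧-difference 0             0         = x≈x-0# 0#
    ⟦⟧-difference 1             0         = trans (x≈x-0# 1#) (+-congʳ (sym (+-identityʳ 1#)))
    ⟦⟧-difference (suc (suc _)) 0         = refl
    ⟦⟧-difference 0             (suc _)   = refl
    ⟦⟧-difference 1             (suc _)   = refl
    ⟦⟧-difference (suc (suc _)) (suc _)   = refl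

    +-differences : ∀ p q r s → (p - q) + (r - s) ≈ (p + r) - (q + s)
    +-differences p q r s =
      trans (interchange p (- q) r (- s)) (+-congˡ (-‿+-comm q s))

    *-differences : ∀ p q r s →
      (p - q) * (r - s) ≈ (p * r + q * s) - (q * r + p * s)
    *-differences p q r s = begin
      (p - q) * (r - s)                      ≈⟨ x[y-z]≈xy-xz (p - q) r s ⟩
      (p - q) * r - (p - q) * s              ≈⟨ +-cong ([y-z]x≈yx-zx r p q) (-‿cong ([y-z]x≈yx-zx s p q)) ⟩
      (p * r - q * r) - (p * s - q * s)      ≈⟨ +-congˡ (-‿anti-homo- _ _) ⟩
      (p * r - q * r) + (q * s - p * s)      ≈⟨ +-differences _ _ _ _ ⟩
      (p * r + q * s) - (q * r + p * s)      ∎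

    ι-+-* : ∀ a b c d → ι (a ℕ.* b ℕ.+ c ℕ.* d) ≈ ι a * ι b + ι c * ι d
    ι-+-* a b c d = trans (×-homo-+ 1# (a ℕ.* b) _) (+-cong (×1-homo-* a b) (×1-homo-* c d))

    almostRing : AlmostCommutativeRing c ℓ
    almostRing = fromCommutativeRing R

    morphism : coefficients -Raw-AlmostCommutative⟶ almostRing
    morphism = record
      { ⟦_⟧    = ⟦_⟧
      ; +-homo = λ (a , b) (c , d) → begin
          ⟦ a ℕ.+ c , b ℕ.+ d ⟧            ≈⟨ ⟦⟧-difference (a ℕ.+ c) (b ℕ.+ d) ⟩
          ι (a ℕ.+ c) - ι (b ℕ.+ d)        ≈⟨ +-cong (×-homo-+ 1# a c) (-‿cong (×-homo-+ 1# b d)) ⟩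
          (ι a + ι c) - (ι b + ι d)        ≈⟨ +-differences _ _ _ _ ⟨
          (ι a - ι b) + (ι c - ι d)        ≈⟨ +-cong (⟦⟧-difference a b) (⟦⟧-difference c d) ⟨
          ⟦ a , b ⟧ + ⟦ c , d ⟧            ∎
      ; *-homo = λ (a , b) (c , d) → begin
          ⟦ a ℕ.* c ℕ.+ b ℕ.* d , b ℕ.* c ℕ.+ a ℕ.* d ⟧
            ≈⟨ ⟦⟧-difference (a ℕ.* c ℕ.+ b ℕ.* d) (b ℕ.* c ℕ.+ a ℕ.* d) ⟩
          ι (a ℕ.* c ℕ.+ b ℕ.* d) - ι (b ℕ.* c ℕ.+ a ℕ.* d)
            ≈⟨ +-cong (ι-+-* a c b d) (-‿cong (ι-+-* b c a d)) ⟩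
          (ι a * ι c + ι b * ι d) - (ι b * ι c + ι a * ι d)
            ≈⟨ *-differences _ _ _ _ ⟨
          (ι a - ι b) * (ι c - ι d)
            ≈⟨ *-cong (⟦⟧-difference a b) (⟦⟧-difference c d) ⟨
          ⟦ a , b ⟧ * ⟦ c , d ⟧ ∎
      ; -‿homo = λ (a , b) → begin
          ⟦ b , a ⟧      ≈⟨ ⟦⟧-difference b a ⟩
          ι b - ι a      ≈⟨ -‿anti-homo- _ _ ⟨
          - (ι a - ι b)  ≈⟨ -‿cong (⟦⟧-difference a b) ⟨
          - ⟦ a , b ⟧    ∎
      ; 0-homo = refl
      ; 1-homo = refl
      }

    -- Formal differences are compared by cross sums, as in the Grothendieck group. Literal equality
    -- of pairs would not let the solver recognise a cancelled coefficient such as `(1 , 1)` as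
    -- zero.
    ⟦⟧-equal : ∀ a b c d → a ℕ.+ d ≡ c ℕ.+ b → ⟦ a , b ⟧ ≈ ⟦ c , d ⟧
    ⟦⟧-equal a b c d eq = begin
      ⟦ a , b ⟧  ≈⟨ ⟦⟧-difference a b ⟩
      ι a - ι b  ≈⟨ x∙y⁻¹≈ε⇒x≈y _ _ difference≈0 ⟩
      ι c - ι d  ≈⟨ ⟦⟧-difference c d ⟨
      ⟦ c , d ⟧  ∎
      where
      difference≈0 : (ι a - ι b) - (ι c - ι d) ≈ 0#
      difference≈0 = begin
        (ι a - ι b) - (ι c - ι d)  ≈⟨ +-congˡ (-‿anti-homo- _ _) ⟩
        (ι a - ι b) + (ι d - ι c)  ≈⟨ +-differences _ _ _ _ ⟩
        (ι a + ι d) - (ι b + ι c)  ≈⟨ +-cong (×-homo-+ 1# a d) (-‿cong (trans (×-homo-+ 1# c b) (+-comm _ _))) ⟨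
        ι (a ℕ.+ d) - ι (c ℕ.+ b)  ≡⟨ ≡.cong (λ k → ι k - ι (c ℕ.+ b)) eq ⟩
        ι (c ℕ.+ b) - ι (c ℕ.+ b)  ≈⟨ -‿inverseʳ _ ⟩
        0#                         ∎

    _≟ᶜ_ : WeaklyDecidable (Induced-equivalence morphism)
    (a , b) ≟ᶜ (c , d) =
      Maybe.map (⟦⟧-equal a b c d) (dec⇒maybe (a ℕ.+ d ℕ.≟ c ℕ.+ b))

  open Algebra.Solver.Ring coefficients almostRing morphism _≟ᶜ_ public
    using (solve; con; _:+_; _:*_; _:-_; _:=_; Polynomial)

  :0 :1 : ∀ {n} → Polynomial n
  :0 = con (0 , 0)
  :1 = con (1 , 0)

module LinearAlgebra {c ℓ₁ ℓ₂}
  (K : HeytingField c ℓ₁ ℓ₂) (char0 : CharacteristicZero K) where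

  open Field K char0 hiding (zero)

  private
    commutativeRing : CommutativeRing c ℓ₁
    commutativeRing =
      HeytingCommutativeRing.commutativeRing heytingCommutativeRing

  open IntegerCoefficients commutativeRing
  open Algebra.Properties.Semiring.Sum (semiring K)
    using (sum; sum-cong-≋; ∑-distrib-+; ∑-comm; sum-replicate-zero;
           *-distribˡ-sum; *-distribʳ-sum)
  open Algebra.Properties.Semiring.Mult (semiring K)
    using (×-homo-+; ×1-homo-*)
  open Relation.Binary.Reasoning.Setoid setoid

  private variable
    l m n p : ℕ

  -- Field inverses

  fromℕ*1/ : ∀ d .{{_ : NonZero d}} → fromℕ d * 1/ d ≈ 1#
  -- Apartness from `0#` yields an inverse of the difference `fromℕ d - 0#`, hence the rewriting of
  -- the left factor.
  fromℕ*1/ d = trans (*-congʳ (lemma (fromℕ d))) (proj₂ (proj₂ (#⇒invertible (char0 d))))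
    where
    lemma : ∀ x → x ≈ x - 0#
    lemma = solve 1 (λ x → x := x :- :0) refl

  fromℕ-1/-* : ∀ d .{{_ : NonZero d}} x → fromℕ d * (1/ d * x) ≈ x
  fromℕ-1/-* d x = trans (sym (*-assoc (fromℕ d) (1/ d) x))
    (trans (*-congʳ (fromℕ*1/ d)) (*-identityˡ x))

  -- Used to prove an equation after multiplying it by a pivot or by `n`.
  fromℕ-cancel : ∀ d .{{_ : NonZero d}} {x y} →
                 fromℕ d * x ≈ fromℕ d * y → x ≈ y
  fromℕ-cancel d {x} {y} eq = begin
    x                     ≈⟨ inverse-* x ⟨
    1/ d * (fromℕ d * x)  ≈⟨ *-congˡ eq ⟩
    1/ d * (fromℕ d * y)  ≈⟨ inverse-* y ⟩
    y                     ∎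
    where
    swap : ∀ a b z → a * (b * z) ≈ b * (a * z)
    swap = solve 3 (λ a b z → a :* (b :* z) := b :* (a :* z)) refl

    inverse-* : ∀ z → 1/ d * (fromℕ d * z) ≈ z
    inverse-* z = trans (swap (1/ d) (fromℕ d) z) (fromℕ-1/-* d z)

  -- Sums and indicators

  sum-minus : (f g : Vector Carrier n) →
                  sum (λ i → f i - g i) ≈ sum f - sum g
  sum-minus {zero}  f g = sym (-‿inverseʳ 0#)
  sum-minus {suc n} f g = trans (+-congˡ (sum-minus (f ∘ suc) (g ∘ suc)))
    (regroup (f zero) (g zero) _ _)
    where
    regroup : ∀ a b s t → a - b + (s - t) ≈ a + s - (b + t)
    regroup = solve 4 (λ a b s t → a :- b :+ (s :- t) := a :+ s :- (b :+ t)) refl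

  sum-0 : {f : Vector Carrier n} → (∀ i → f i ≈ 0#) → sum f ≈ 0#
  sum-0 {n} eq = trans (sum-cong-≋ eq) (sum-replicate-zero n)

  sum-const : ∀ n x → sum {n} (λ _ → x) ≈ fromℕ n * x
  sum-const zero    x = sym (zeroˡ x)
  sum-const (suc n) x = trans (+-congˡ (sum-const n x)) (factor x (fromℕ n))
    where
    factor : ∀ x y → x + y * x ≈ (1# + y) * x
    factor = solve 2 (λ x y → x :+ y :* x := (:1 :+ y) :* x) refl

  fromℕ-total : (a : Fin n → ℕ) → fromℕ (total a) ≈ sum (fromℕ ∘ a)
  fromℕ-total {zero}  a = refl
  fromℕ-total {suc n} a =
    trans (×-homo-+ 1# (a zero) _) (+-congˡ (fromℕ-total (a ∘ suc)))

  indicator-yes : ∀ {a} {A : Set a} (a? : Dec A) → A → indicator a? ≡ 1#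
  indicator-yes a? a = ≡.cong (if_then 1# else 0#) (dec-true a? a)

  indicator-no : ∀ {a} {A : Set a} (a? : Dec A) → ¬ A → indicator a? ≡ 0#
  indicator-no a? ¬a = ≡.cong (if_then 1# else 0#) (dec-false a? ¬a)

  indicator-⇔ : ∀ {a b} {A : Set a} {B : Set b} (a? : Dec A) (b? : Dec B) →
                (A → B) → (B → A) → indicator a? ≡ indicator b?
  indicator-⇔ a? b? f g =
    ≡.cong (if_then 1# else 0#) (does-⇔ (mk⇔ f g) a? b?)

  basis-sym : (x y : Fin n) → basis x y ≡ basis y x
  basis-sym x y = indicator-⇔ (x ≟ y) (y ≟ x) ≡.sym ≡.sym

  basis-∙ : (x : Fin n) (g : Vector Carrier n) → basis x ∙ g ≈ g x
  basis-∙ zero    g =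
    trans (+-cong (*-identityˡ _) (sum-0 λ i → zeroˡ (g (suc i)))) (+-identityʳ _)
  basis-∙ (suc x) g =
    trans (+-cong (zeroˡ _) (basis-∙ x (g ∘ suc))) (+-identityˡ _)

  sum-basis : (x : Fin n) → sum (basis x) ≈ 1#
  sum-basis x = trans (sum-cong-≋ λ i → sym (*-identityʳ (basis x i)))
                      (basis-∙ x λ _ → 1#)

  -- With at most one witness, counting witnesses and testing for one agree. Through this lemma the
  -- distinctness of the deleted edges enters the proof.
  sum-indicator-unique : ∀ {a} {P : Fin n → Set a} (P? : Decidable P) →
    (∀ {i j} → P i → P j → i ≡ j) →
    sum (λ i → indicator (P? i)) ≈ indicator (any? P?)
  sum-indicator-unique P? unique with any? P?
  ... | yes (i , Pi) = trans
    (sum-cong-≋ λ j → reflexive (indicator-⇔ (P? j) (i ≟ j) (unique Pi) λ { ≡.refl → Pi }))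
    (sum-basis i)
  ... | no ¬∃ = sum-0 λ i → reflexive (indicator-no (P? i) λ Pi → ¬∃ (i , Pi))

  -- The list in `degree` is `tabulate id`; a general `f` lets the induction pass to `f ∘ suc`.
  fromℕ-length-filter : ∀ {a b} {A : Set a} {P : A → Set b} (P? : Decidable P)
    (f : Fin n → A) →
    fromℕ (length (filter P? (tabulate f))) ≈ sum (λ i → indicator (P? (f i)))
  fromℕ-length-filter {zero}  P? f = refl
  fromℕ-length-filter {suc n} P? f with does (P? (f zero))
  ... | true  = +-congˡ (fromℕ-length-filter P? (f ∘ suc))
  ... | false = trans (fromℕ-length-filter P? (f ∘ suc)) (sym (+-identityˡ _))

  -- Dot products and matrices

  ∙-cong : {u u′ v v′ : Vector Carrier n} →
           (∀ i → u i ≈ u′ i) → (∀ i → v i ≈ v′ i) → u ∙ v ≈ u′ ∙ v′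
  ∙-cong u≈u′ v≈v′ = sum-cong-≋ λ i → *-cong (u≈u′ i) (v≈v′ i)

  ∙-comm : (u v : Vector Carrier n) → u ∙ v ≈ v ∙ u
  ∙-comm u v = sum-cong-≋ λ i → *-comm (u i) (v i)

  ∙-plus : (u v w : Vector Carrier n) → u ∙ (λ i → v i + w i) ≈ u ∙ v + u ∙ w
  ∙-plus {n} u v w = trans (sum-cong-≋ λ i → distribˡ (u i) (v i) (w i)) (∑-distrib-+ {n} _ _)

  ∙-minus : (u v w : Vector Carrier n) → u ∙ (v -ᵛ w) ≈ u ∙ v - u ∙ w
  ∙-minus {n} u v w = trans (sum-cong-≋ λ i → lemma (u i) (v i) (w i)) (sum-minus {n} _ _)
    where
    lemma : ∀ a b c → a * (b - c) ≈ a * b - a * c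
    lemma = solve 3 (λ a b c → a :* (b :- c) := a :* b :- a :* c) refl

  ∙-scale : (u : Vector Carrier n) (a : Carrier) (v : Vector Carrier n) →
            u ∙ (λ i → a * v i) ≈ a * (u ∙ v)
  ∙-scale {n} u a v = trans (sum-cong-≋ λ i → lemma (u i) a (v i)) (sym (*-distribˡ-sum {n} a _))
    where
    lemma : ∀ x a y → x * (a * y) ≈ a * (x * y)
    lemma = solve 3 (λ x a y → x :* (a :* y) := a :* (x :* y)) refl

  ∙-const : (u : Vector Carrier n) (a : Carrier) → u ∙ (λ _ → a) ≈ sum u * a
  ∙-const u a = sym (*-distribʳ-sum a u)

  basis-difference-∙ : (x y : Fin n) (g : Vector Carrier n) →
                       (basis x -ᵛ basis y) ∙ g ≈ g x - g y
  basis-difference-∙ x y g = begin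
    (basis x -ᵛ basis y) ∙ g  ≈⟨ ∙-comm _ g ⟩
    g ∙ (basis x -ᵛ basis y)  ≈⟨ ∙-minus g _ _ ⟩
    g ∙ basis x - g ∙ basis y ≈⟨ +-cong (value x) (-‿cong (value y)) ⟩
    g x - g y                 ∎
    where
    value : ∀ z → g ∙ basis z ≈ g z
    value z = trans (∙-comm g _) (basis-∙ z g)

  ∙-*ᵛ : (A : Matrix m n) (u : Vector Carrier m) (v : Vector Carrier n) →
         u ∙ (A *ᵛ v) ≈ (A ᵀ *ᵛ u) ∙ v
  ∙-*ᵛ {m} {n} A u v = begin
    sum (λ i → u i * sum (λ j → A i j * v j))    ≈⟨ sum-cong-≋ (λ i → *-distribˡ-sum {n} (u i) _) ⟩
    sum (λ i → sum (λ j → u i * (A i j * v j)))  ≈⟨ ∑-comm {m} {n} _ ⟩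
    sum (λ j → sum (λ i → u i * (A i j * v j)))  ≈⟨ sum-cong-≋ (λ j → sum-cong-≋ λ i → regroup (u i) (A i j) (v j)) ⟩
    sum (λ j → sum (λ i → A i j * u i * v j))    ≈⟨ sum-cong-≋ (λ j → *-distribʳ-sum (v j) λ i → A i j * u i) ⟨
    sum (λ j → sum (λ i → A i j * u i) * v j)    ∎
    where
    regroup : ∀ a b c → a * (b * c) ≈ b * a * c
    regroup = solve 3 (λ a b c → a :* (b :* c) := b :* a :* c) refl

  *ᵛ-cong : (A : Matrix m n) {u v : Vector Carrier n} →
            (∀ i → u i ≈ v i) → ∀ i → (A *ᵛ u) i ≈ (A *ᵛ v) i
  *ᵛ-cong A u≈v i = ∙-cong (λ _ → refl) u≈v

  *ᵛ-assoc : (A : Matrix l m) (C : Matrix m n) (v : Vector Carrier n) →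
             ∀ i → ((A *ᴹ C) *ᵛ v) i ≈ (A *ᵛ (C *ᵛ v)) i
  *ᵛ-assoc A C v i = trans
    -- Row `i` of the product is `C ᵀ` applied to row `i` of `A`, so associativity is an instance of
    -- adjointness.
    (∙-cong (λ j → ∙-comm (A i) ((C ᵀ) j)) λ _ → refl)
    (sym (∙-*ᵛ C (A i) v))

  -- Symmetric matrices and their inverses.

  Symmetricᴹ : Matrix n n → Set ℓ₁
  Symmetricᴹ A = A ᵀ ≈ᴹ A

  *ᴹ-transpose : {A C : Matrix n n} → Symmetricᴹ A → Symmetricᴹ C →
                 (A *ᴹ C) ᵀ ≈ᴹ C *ᴹ A
  *ᴹ-transpose {A = A} {C} A-sym C-sym i j = trans
    (∙-comm (A j) ((C ᵀ) i)) (∙-cong (λ k → C-sym i k) (λ k → A-sym k j))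

  ∙-*ᵛ-symmetric : (A : Matrix n n) → Symmetricᴹ A → (u v : Vector Carrier n) →
                   u ∙ (A *ᵛ v) ≈ (A *ᵛ u) ∙ v
  ∙-*ᵛ-symmetric A A-sym u v = trans (∙-*ᵛ A u v)
    (∙-cong (λ i → ∙-cong (A-sym i) λ _ → refl) λ _ → refl)

  -- The hypothesis writes the entries of `C` as values of the bilinear form of `A` on the columns
  -- of `C`, and this form is symmetric.
  symmetric-from-energy : {A C : Matrix n n} → Symmetricᴹ A →
    (∀ i j → C i j ≈ (A *ᵛ (C ᵀ) i) ∙ (C ᵀ) j) → Symmetricᴹ C
  symmetric-from-energy {A = A} {C} A-sym energy i j = begin
    C j i                    ≈⟨ energy j i ⟩
    (A *ᵛ (C ᵀ) j) ∙ (C ᵀ) i ≈⟨ ∙-*ᵛ-symmetric A A-sym ((C ᵀ) j) ((C ᵀ) i) ⟨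
    (C ᵀ) j ∙ (A *ᵛ (C ᵀ) i) ≈⟨ ∙-comm ((C ᵀ) j) (A *ᵛ (C ᵀ) i) ⟩
    (A *ᵛ (C ᵀ) i) ∙ (C ᵀ) j ≈⟨ energy i j ⟨
    C i j                    ∎

  -- Solving for the basis vectors gives the columns of a right inverse. It is symmetric by the
  -- energy argument, so transposing `A C = I` makes it a left inverse too.
  symmetric-solvable⇒invertible : (A : Matrix n n) → Symmetricᴹ A →
    (∀ f → ∃ λ g → ∀ i → (A *ᵛ g) i ≈ f i) → Invertible A
  symmetric-solvable⇒invertible {n} A A-sym solve = C , CA≈I , AC≈I
    where
    C : Matrix n n
    C i j = proj₁ (solve (basis j)) i

    AC≈I : A *ᴹ C ≈ᴹ I
    AC≈I i j = trans (proj₂ (solve (basis j)) i) (reflexive (basis-sym j i))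

    C-sym : Symmetricᴹ C
    C-sym = symmetric-from-energy A-sym λ i j → begin
      C i j                    ≈⟨ basis-∙ i ((C ᵀ) j) ⟨
      basis i ∙ (C ᵀ) j        ≈⟨ ∙-cong (proj₂ (solve (basis i))) (λ _ → refl) ⟨
      (A *ᵛ (C ᵀ) i) ∙ (C ᵀ) j ∎

    CA≈I : C *ᴹ A ≈ᴹ I
    CA≈I i j = trans (sym (*ᴹ-transpose A-sym C-sym i j))
      (trans (AC≈I j i) (reflexive (basis-sym j i)))

  -- The Poisson equation on a weighted graph

  -- In this difference form diagonal weights contribute nothing, so the loops created by `starMesh`
  -- are harmless.
  weightedLaplacian : Weights n → Vector Carrier n → Vector Carrier n
  weightedLaplacian w g u = sum λ v → fromℕ (w u v) * (g u - g v)

  sum-*-difference : (a g : Vector Carrier n) (x : Carrier) →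
    sum (λ v → a v * (x - g v)) ≈ sum a * x - a ∙ g
  sum-*-difference a g x = trans (∙-minus a (λ _ → x) g) (+-congʳ (∙-const a x))

  -- One step of Gaussian elimination: the equation at `zero` is solved for `g zero`, and
  -- substituting it into the others leaves the Schur complement. Multiplied by the pivot `d`, this
  -- is the Laplacian of `starMesh w`.
  poisson-step : (w : Weights (suc n)) → (∀ u v → w u v ≡ w v u) →
    0 < total (w zero ∘ suc) →
    (∀ f → sum f ≈ 0# → ∃ λ g → ∀ u → weightedLaplacian (starMesh w) g u ≈ f u) →
    ∀ f → sum f ≈ 0# → ∃ λ g → ∀ u → weightedLaplacian w g u ≈ f u
  poisson-step {n} w w-sym d>0 solve-reduced f Σf≈0 = g , λ
    { zero → at-0 ; (suc u) → fromℕ-cancel d (at-suc u) }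
    where
    d : ℕ
    d = total (w zero ∘ suc)

    instance
      d≢0 : NonZero d
      d≢0 = >-nonZero d>0

    D : Carrier
    D = fromℕ d

    a : Vector Carrier n
    a v = fromℕ (w zero (suc v))

    D≈Σa : D ≈ sum a
    D≈Σa = fromℕ-total (w zero ∘ suc)

    f′ : Vector Carrier n
    -- `D` times the equation at `suc u` plus `a u` times the equation at `zero`: the combination in
    -- which `g zero` cancels.
    f′ u = D * f (suc u) + a u * f zero

    Σf′≈0 : sum f′ ≈ 0#
    Σf′≈0 = begin
      sum f′                                  ≈⟨ ∑-distrib-+ {n} _ _ ⟩
      sum (λ u → D * f (suc u)) + sum (λ u → a u * f zero)
        ≈⟨ +-cong (*-distribˡ-sum {n} D _) (*-distribʳ-sum (f zero) a) ⟨
      D * sum (f ∘ suc) + sum a * f zero      ≈⟨ +-congˡ (*-congʳ D≈Σa) ⟨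
      D * sum (f ∘ suc) + D * f zero          ≈⟨ lemma D _ _ ⟩
      D * sum f                               ≈⟨ *-congˡ Σf≈0 ⟩
      D * 0#                                  ≈⟨ zeroʳ D ⟩
      0#                                      ∎
      where
      lemma : ∀ D s x → D * s + D * x ≈ D * (x + s)
      lemma = solve 3 (λ D s x → D :* s :+ D :* x := D :* (x :+ s)) refl

    reduced : ∃ λ g′ → ∀ u → weightedLaplacian (starMesh w) g′ u ≈ f′ u
    reduced = solve-reduced f′ Σf′≈0

    g′ : Vector Carrier n
    g′ = proj₁ reduced

    g : Vector Carrier (suc n)
    -- The equation at `zero` reads `D * g zero - a ∙ g′ ≈ f zero`.
    g zero    = 1/ d * (f zero + a ∙ g′)
    g (suc u) = g′ u

    Dg₀ : D * g zero ≈ f zero + a ∙ g′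
    Dg₀ = fromℕ-1/-* d (f zero + a ∙ g′)

    at-0 : weightedLaplacian w g zero ≈ f zero
    at-0 = begin
      fromℕ (w zero zero) * (g zero - g zero) + sum (λ v → a v * (g zero - g′ v))
        ≈⟨ +-cong (lemma₁ _ _) (sum-*-difference a g′ (g zero)) ⟩
      0# + (sum a * g zero - a ∙ g′)
        ≈⟨ +-congˡ (+-congʳ (trans (*-congʳ (sym D≈Σa)) Dg₀)) ⟩
      0# + (f zero + a ∙ g′ - a ∙ g′)
        ≈⟨ lemma₂ (f zero) (a ∙ g′) ⟩
      f zero ∎
      where
      lemma₁ : ∀ x y → x * (y - y) ≈ 0#
      lemma₁ = solve 2 (λ x y → x :* (y :- y) := :0) refl
      lemma₂ : ∀ x y → 0# + (x + y - y) ≈ x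
      lemma₂ = solve 2 (λ x y → :0 :+ (x :+ y :- y) := x) refl

    -- With the factor `D` present, `D * g zero` can be replaced through `Dg₀`; `fromℕ-cancel`
    -- removes the factor afterwards.
    at-suc : ∀ u → D * weightedLaplacian w g (suc u) ≈ D * f (suc u)
    at-suc u = begin
      D * (fromℕ (w (suc u) zero) * (g′ u - g zero) + S)
        ≈⟨ *-congˡ (+-congʳ (*-congʳ (reflexive (≡.cong fromℕ (w-sym (suc u) zero))))) ⟩
      D * (a u * (g′ u - g zero) + S)
        ≈⟨ expand D (a u) (g′ u) (g zero) S ⟩
      a u * (D * g′ u - D * g zero) + D * S
        ≈⟨ +-congʳ (*-congˡ (+-congˡ (-‿cong Dg₀))) ⟩
      a u * (D * g′ u - (f zero + a ∙ g′)) + D * S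
        ≈⟨ regroup (a u) (D * g′ u) (f zero) (a ∙ g′) (D * S) ⟩
      a u * (D * g′ u - a ∙ g′) + D * S - a u * f zero
        ≈⟨ +-congʳ (reduced-at) ⟨
      weightedLaplacian (starMesh w) g′ u - a u * f zero
        ≈⟨ +-congʳ (proj₂ reduced u) ⟩
      D * f (suc u) + a u * f zero - a u * f zero
        ≈⟨ cancel _ _ ⟩
      D * f (suc u) ∎
      where
      b : Vector Carrier n
      b v = fromℕ (w (suc u) (suc v))

      S : Carrier
      S = sum λ v → b v * (g′ u - g′ v)

      expand : ∀ D a x y S → D * (a * (x - y) + S) ≈ a * (D * x - D * y) + D * S
      expand = solve 5 (λ D a x y S → D :* (a :* (x :- y) :+ S) := a :* (D :* x :- D :* y) :+ D :* S) refl

      regroup : ∀ a x f t s → a * (x - (f + t)) + s ≈ a * (x - t) + s - a * f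
      regroup = solve 5 (λ a x f t s → a :* (x :- (f :+ t)) :+ s := a :* (x :- t) :+ s :- a :* f) refl

      cancel : ∀ x y → x + y - y ≈ x
      cancel = solve 2 (λ x y → x :+ y :- y := x) refl

      distribute : ∀ a c D b x → (a * c + D * b) * x ≈ a * (c * x) + D * (b * x)
      distribute = solve 5 (λ a c D b x → (a :* c :+ D :* b) :* x := a :* (c :* x) :+ D :* (b :* x)) refl

      fromℕ-starMesh : ∀ v → fromℕ (starMesh w u v) ≈ a u * a v + D * b v
      fromℕ-starMesh v = begin
        fromℕ (starMesh w u v)
          ≈⟨ ×-homo-+ 1# (w (suc u) zero ℕ.* w zero (suc v)) _ ⟩
        fromℕ (w (suc u) zero ℕ.* w zero (suc v)) + fromℕ (d ℕ.* w (suc u) (suc v))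
          ≈⟨ +-cong (×1-homo-* (w (suc u) zero) _) (×1-homo-* d _) ⟩
        fromℕ (w (suc u) zero) * a v + D * b v
          ≡⟨ ≡.cong (λ k → fromℕ k * a v + D * b v) (w-sym (suc u) zero) ⟩
        a u * a v + D * b v ∎

      reduced-at : weightedLaplacian (starMesh w) g′ u ≈
                   a u * (D * g′ u - a ∙ g′) + D * S
      reduced-at = begin
        sum (λ v → fromℕ (starMesh w u v) * (g′ u - g′ v))
          ≈⟨ sum-cong-≋ (λ v → trans (*-congʳ (fromℕ-starMesh v))
               (distribute (a u) (a v) D (b v) (g′ u - g′ v))) ⟩
        sum (λ v → a u * (a v * (g′ u - g′ v)) + D * (b v * (g′ u - g′ v)))
          ≈⟨ ∑-distrib-+ {n} _ _ ⟩
        sum (λ v → a u * (a v * (g′ u - g′ v))) + sum (λ v → D * (b v * (g′ u - g′ v)))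
          ≈⟨ +-cong (*-distribˡ-sum {n} (a u) _) (*-distribˡ-sum {n} D _) ⟨
        a u * sum (λ v → a v * (g′ u - g′ v)) + D * S
          ≈⟨ +-congʳ (*-congˡ (sum-*-difference a g′ (g′ u))) ⟩
        a u * (sum a * g′ u - a ∙ g′) + D * S
          ≈⟨ +-congʳ (*-congˡ (+-congʳ (*-congʳ D≈Σa))) ⟨
        a u * (D * g′ u - a ∙ g′) + D * S ∎

  -- Induction on the number of vertices. Symmetry and connectedness pass to `starMesh w`, and
  -- connectedness makes every pivot positive as long as a second vertex remains.
  poisson : (w : Weights n) → (∀ u v → w u v ≡ w v u) →
    (∀ u v → Star (Linked w) u v) →
    (f : Vector Carrier n) → sum f ≈ 0# →
    ∃ λ g → ∀ u → weightedLaplacian w g u ≈ f u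
  poisson {zero} w w-sym connected f Σf≈0 = f , λ ()
  -- On one vertex the Laplacian vanishes, and `f zero` is zero because it is the whole sum.
  poisson {suc zero} w w-sym connected f Σf≈0 = (λ _ → 0#) , λ
    { zero → trans (lemma (fromℕ (w zero zero)))
                   (trans (sym Σf≈0) (+-identityʳ (f zero))) }
    where
    lemma : ∀ a → a * (0# - 0#) + 0# ≈ 0#
    lemma = solve 1 (λ a → a :* (:0 :- :0) :+ :0 := :0) refl
  poisson {suc (suc n)} w w-sym connected = poisson-step w w-sym d>0
    (poisson (starMesh w) (starMesh-sym w w-sym)
      λ u v → starMesh-path w d>0 (connected (suc u) (suc v)))
    where
    d>0 : 0 < total (w zero ∘ suc)
    d>0 = degree-positive w (connected zero (suc zero))

  -- Graph Laplacians

  adjacencyWeights : Graph n → Weights n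
  adjacencyWeights G u v = if does (u ~? v) then 1 else 0
    where open Graph G

  module _ (G : Graph n) where
    open Graph G

    adjacencyWeights-sym : ∀ u v → adjacencyWeights G u v ≡ adjacencyWeights G v u
    adjacencyWeights-sym u v = ≡.cong (if_then 1 else 0)
      (does-⇔ (mk⇔ ~-sym ~-sym) (u ~? v) (v ~? u))

    ~⇒Linked : ∀ {u v} → u ~ v → Linked (adjacencyWeights G) u v
    ~⇒Linked {u} {v} u~v =
      ≡.subst (λ b → 0 < (if b then 1 else 0)) (≡.sym (dec-true (u ~? v) u~v)) ℕ.≤-refl

    fromℕ-adjacency : ∀ u v → fromℕ (adjacencyWeights G u v) ≈ adjacencyMatrix G u v
    fromℕ-adjacency u v with does (u ~? v)
    ... | true  = +-identityʳ 1#
    ... | false = refl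

    fromℕ-degree : ∀ u → fromℕ (degree u) ≈ sum (adjacencyMatrix G u)
    fromℕ-degree u = fromℕ-length-filter (u ~?_) id

    degreeMatrix-∙ : ∀ u g → degreeMatrix G u ∙ g ≈ fromℕ (degree u) * g u
    degreeMatrix-∙ u g = begin
      degreeMatrix G u ∙ g                   ≈⟨ ∙-comm (degreeMatrix G u) g ⟩
      g ∙ degreeMatrix G u                   ≈⟨ ∙-cong (λ _ → refl) (λ v → entry (does (u ≟ v))) ⟩
      g ∙ (λ v → fromℕ (degree u) * basis u v) ≈⟨ ∙-scale g (fromℕ (degree u)) (basis u) ⟩
      fromℕ (degree u) * (g ∙ basis u)       ≈⟨ *-congˡ (trans (∙-comm g (basis u)) (basis-∙ u g)) ⟩
      fromℕ (degree u) * g u                 ∎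
      where
      entry : ∀ {x} b → (if b then x else 0#) ≈ x * (if b then 1# else 0#)
      entry true  = sym (*-identityʳ _)
      entry false = sym (zeroʳ _)

    -- The degree is a row sum of the adjacency matrix, so the two parts of the Laplacian combine
    -- into differences. Constants in the kernel and invariance under shifts are read off from this
    -- form.
    laplacian-*ᵛ : ∀ g u →
      (laplacian G *ᵛ g) u ≈ sum (λ v → adjacencyMatrix G u v * (g u - g v))
    laplacian-*ᵛ g u = begin
      laplacian G u ∙ g
        ≈⟨ ∙-comm (laplacian G u) g ⟩
      g ∙ laplacian G u
        ≈⟨ ∙-minus g (degreeMatrix G u) (adjacencyMatrix G u) ⟩
      g ∙ degreeMatrix G u - g ∙ adjacencyMatrix G u
        ≈⟨ +-cong (∙-comm g (degreeMatrix G u)) (-‿cong (∙-comm g (adjacencyMatrix G u))) ⟩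
      degreeMatrix G u ∙ g - adjacencyMatrix G u ∙ g
        ≈⟨ +-congʳ (trans (degreeMatrix-∙ u g) (*-congʳ (fromℕ-degree u))) ⟩
      sum (adjacencyMatrix G u) * g u - adjacencyMatrix G u ∙ g
        ≈⟨ sum-*-difference (adjacencyMatrix G u) g (g u) ⟨
      sum (λ v → adjacencyMatrix G u v * (g u - g v)) ∎

    laplacian-shift : ∀ g a u →
      (laplacian G *ᵛ (λ i → g i - a)) u ≈ (laplacian G *ᵛ g) u
    laplacian-shift g a u = begin
      (laplacian G *ᵛ (λ i → g i - a)) u
        ≈⟨ laplacian-*ᵛ (λ i → g i - a) u ⟩
      sum (λ v → adjacencyMatrix G u v * (g u - a - (g v - a)))
        ≈⟨ sum-cong-≋ (λ v → lemma (adjacencyMatrix G u v) (g u) (g v) a) ⟩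
      sum (λ v → adjacencyMatrix G u v * (g u - g v))
        ≈⟨ laplacian-*ᵛ g u ⟨
      (laplacian G *ᵛ g) u ∎
      where
      lemma : ∀ w x y a → w * (x - a - (y - a)) ≈ w * (x - y)
      lemma = solve 4 (λ w x y a → w :* (x :- a :- (y :- a)) := w :* (x :- y)) refl

    laplacian-const : ∀ a u → (laplacian G *ᵛ (λ _ → a)) u ≈ 0#
    laplacian-const a u = trans (laplacian-*ᵛ (λ _ → a) u)
      (sum-0 λ v → trans (*-congˡ (-‿inverseʳ a)) (zeroʳ (adjacencyMatrix G u v)))

    laplacian-sym : Symmetricᴹ (laplacian G)
    laplacian-sym u v = +-cong (degree-entry (u ≟ v))
      (-‿cong (reflexive (indicator-⇔ (v ~? u) (u ~? v) ~-sym ~-sym)))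
      where
      degree-entry : Dec (u ≡ v) → degreeMatrix G v u ≈ degreeMatrix G u v
      degree-entry (yes ≡.refl) = refl
      degree-entry (no u≢v)     = reflexive (≡.trans
        (≡.cong (if_then fromℕ (degree v) else 0#) (dec-false (v ≟ u) (u≢v ∘ ≡.sym)))
        (≡.sym (≡.cong (if_then fromℕ (degree u) else 0#) (dec-false (u ≟ v) u≢v))))

    laplacian-solvable : .{{_ : NonZero n}} → Connected →
      ∀ f → sum f ≈ 0# →
      ∃ λ g → (∀ u → (laplacian G *ᵛ g) u ≈ f u) × sum g ≈ 0#
    laplacian-solvable connected f Σf≈0 = g , Lg≈f , Σg≈0
      where
      potential = poisson (adjacencyWeights G) adjacencyWeights-sym
        (λ u v → gmap id ~⇒Linked (connected u v)) f Σf≈0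

      h g : Vector Carrier n
      h   = proj₁ potential
      -- Potentials may be shifted by a constant; subtracting the mean selects the one with sum
      -- zero.
      g i = h i - 1/ n * sum h

      Lg≈f : ∀ u → (laplacian G *ᵛ g) u ≈ f u
      Lg≈f u = begin
        (laplacian G *ᵛ g) u
          ≈⟨ laplacian-shift h (1/ n * sum h) u ⟩
        (laplacian G *ᵛ h) u
          ≈⟨ laplacian-*ᵛ h u ⟩
        sum (λ v → adjacencyMatrix G u v * (h u - h v))
          ≈⟨ sum-cong-≋ (λ v → *-congʳ (fromℕ-adjacency u v)) ⟨
        weightedLaplacian (adjacencyWeights G) h u
          ≈⟨ proj₂ potential u ⟩
        f u ∎

      Σg≈0 : sum g ≈ 0#
      Σg≈0 = begin
        sum g                               ≈⟨ sum-minus h (λ _ → 1/ n * sum h) ⟩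
        sum h - sum {n} (λ _ → 1/ n * sum h) ≈⟨ +-congˡ (-‿cong (sum-const n (1/ n * sum h))) ⟩
        sum h - fromℕ n * (1/ n * sum h)    ≈⟨ +-congˡ (-‿cong (fromℕ-1/-* n (sum h))) ⟩
        sum h - sum h                       ≈⟨ -‿inverseʳ (sum h) ⟩
        0#                                  ∎

  -- Pseudoinverses of matrices with kernel spanned by the constant vectors

  -- This is `I - J / n`, the projection onto the sum-zero vectors along the constants.
  centering : .{{_ : NonZero n}} → Matrix n n
  centering {n} i j = basis i j - 1/ n

  centering-∙ : .{{_ : NonZero n}} {a : Vector Carrier n} (i : Fin n) →
    (∀ k → a k ≈ centering i k) → ∀ {x} → sum x ≈ 0# → a ∙ x ≈ x i
  centering-∙ {n} {a} i a≈ {x} Σx≈0 = begin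
    a ∙ x                            ≈⟨ ∙-comm a x ⟩
    x ∙ a                            ≈⟨ ∙-cong (λ _ → refl) a≈ ⟩
    x ∙ (basis i -ᵛ (λ _ → 1/ n))    ≈⟨ ∙-minus x (basis i) (λ _ → 1/ n) ⟩
    x ∙ basis i - x ∙ (λ _ → 1/ n)   ≈⟨ +-cong (trans (∙-comm x (basis i)) (basis-∙ i x)) (-‿cong (∙-const x (1/ n))) ⟩
    x i - sum x * 1/ n               ≈⟨ +-congˡ (-‿cong (*-congʳ Σx≈0)) ⟩
    x i - 0# * 1/ n                  ≈⟨ lemma (x i) (1/ n) ⟩
    x i                              ∎
    where
    lemma : ∀ x y → x - 0# * y ≈ x
    lemma = solve 2 (λ x y → x :- :0 :* y := x) refl

  -- Write `P` for `centering`. The columns of `A` and `C` have sum zero, so `P A = A` and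
  -- `P C = C`. Since `A C = P` and, by symmetry of `C`, also `C A = P`, all four Penrose conditions
  -- follow from this and the symmetry of `P`.
  centering⇒MoorePenroseInverse : .{{_ : NonZero n}} (A : Matrix n n) → Symmetricᴹ A →
    (∀ i → sum ((A ᵀ) i) ≈ 0#) →
    (C : Matrix n n) → A *ᴹ C ≈ᴹ centering → (∀ i → sum ((C ᵀ) i) ≈ 0#) →
    MoorePenroseInverse A
  centering⇒MoorePenroseInverse {n} A A-sym ΣA≈0 C AC≈ ΣC≈0 = record
    { A⁺       = C
    ; AA⁺A≈A   = λ i j → centering-∙ i (AC≈ i) (ΣA≈0 j)
    ; A⁺AA⁺≈A⁺ = λ i j → centering-∙ i (CA≈ i) (ΣC≈0 j)
    ; AA⁺-sym  = λ i j → trans (AC≈ j i) (trans (centering-sym j i) (sym (AC≈ i j)))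
    ; A⁺A-sym  = λ i j → trans (CA≈ j i) (trans (centering-sym j i) (sym (CA≈ i j)))
    }
    where
    centering-sym : ∀ i j → centering i j ≈ centering j i
    centering-sym i j = +-congʳ (reflexive (basis-sym i j))

    C-sym : Symmetricᴹ C
    -- `A` sends column `i` of `C` to column `i` of the projection, whose product with the sum-zero
    -- column `j` of `C` is `C i j`.
    C-sym = symmetric-from-energy {A = A} A-sym λ i j →
      sym (centering-∙ i (λ k → trans (AC≈ k i) (centering-sym k i)) (ΣC≈0 j))

    CA≈ : C *ᴹ A ≈ᴹ centering
    CA≈ i j = trans (sym (*ᴹ-transpose {A = A} A-sym C-sym i j))
      (trans (AC≈ j i) (centering-sym j i))

  sum-centering : .{{_ : NonZero n}} (i : Fin n) → sum (λ k → centering k i) ≈ 0#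
  sum-centering {n} i = begin
    sum (λ k → basis k i - 1/ n)                  ≈⟨ sum-minus (λ k → basis k i) (λ _ → 1/ n) ⟩
    sum (λ k → basis k i) - sum {n} (λ _ → 1/ n)  ≈⟨ +-cong (sum-cong-≋ λ k → reflexive (basis-sym k i)) (-‿cong (sum-const n (1/ n))) ⟩
    sum (basis i) - fromℕ n * 1/ n                ≈⟨ +-cong (sum-basis i) (-‿cong (fromℕ*1/ n)) ⟩
    1# - 1#                                       ≈⟨ -‿inverseʳ 1# ⟩
    0#                                            ∎

  -- The columns of the pseudoinverse are Green functions: the sum-zero potentials of centred unit
  -- sources.
  laplacian-MoorePenroseInverse : .{{_ : NonZero n}} (G : Graph n) →
    Graph.Connected G → MoorePenroseInverse (laplacian G)
  laplacian-MoorePenroseInverse {n} G connected =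
    centering⇒MoorePenroseInverse (laplacian G) (laplacian-sym G)
      -- By symmetry a column sum is a row applied to the constant vector `1#`, which lies in the
      -- kernel.
      (λ i → trans (sum-cong-≋ λ j → trans (laplacian-sym G i j) (sym (*-identityʳ _)))
                   (laplacian-const G 1# i))
      (λ i j → proj₁ (green j) i)
      (λ i j → proj₁ (proj₂ (green j)) i)
      (λ j → proj₂ (proj₂ (green j)))
    where
    green : ∀ j → ∃ λ g → (∀ u → (laplacian G *ᵛ g) u ≈ centering u j) × sum g ≈ 0#
    green j = laplacian-solvable G connected (λ u → centering u j) (sum-centering j)

  -- Incidence matrices

  module _ {G : Graph n} where
    open Graph G using (~-irrefl)

    -- For the column `b` of one edge, `b bᵀ` is the Laplacian of that edge: the orientation sign
    -- occurs twice and cancels. At an endpoint only the opposite endpoint contributes, and at any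
    -- other vertex both sides vanish.
    incidence-edge : (e : Edge G) (g : Vector Carrier n) (u : Fin n) →
      (basis (src e) u - basis (tgt e) u) * (g (src e) - g (tgt e))
        ≈ sum (λ v → indicator (joins? e u v) * (g u - g v))
    incidence-edge e g u = by-cases (src e ≟ u) (tgt e ≟ u)
      where
      Goal : Set _
      Goal = (basis (src e) u - basis (tgt e) u) * (g (src e) - g (tgt e))
               ≈ sum (λ v → indicator (joins? e u v) * (g u - g v))

      basis-≡ : ∀ {x} → x ≡ u → basis x u ≈ 1#
      basis-≡ {x} p = reflexive (indicator-yes (x ≟ u) p)

      basis-≢ : ∀ {x} → x ≢ u → basis x u ≈ 0#
      basis-≢ {x} p = reflexive (indicator-no (x ≟ u) p)

      Σ-neighbour : ∀ {x} → (∀ v → indicator (joins? e u v) ≡ basis x v) →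
        sum (λ v → indicator (joins? e u v) * (g u - g v)) ≈ g u - g x
      Σ-neighbour {x} eq = trans
        (∙-cong (λ v → reflexive (eq v)) (λ _ → refl))
        (basis-∙ x (λ v → g u - g v))

      src-lemma : ∀ x y → (1# - 0#) * (x - y) ≈ x - y
      src-lemma = solve 2 (λ x y → (:1 :- :0) :* (x :- y) := x :- y) refl

      tgt-lemma : ∀ x y → (0# - 1#) * (x - y) ≈ y - x
      tgt-lemma = solve 2 (λ x y → (:0 :- :1) :* (x :- y) := y :- x) refl

      other-lemma : ∀ x y → (0# - 0#) * (x - y) ≈ 0#
      other-lemma = solve 2 (λ x y → (:0 :- :0) :* (x :- y) := :0) refl

      by-cases : Dec (src e ≡ u) → Dec (tgt e ≡ u) → Goal
      by-cases (yes s≡u) (yes t≡u) =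
        contradiction (src~tgt e) (~-irrefl (≡.trans s≡u (≡.sym t≡u)))
      by-cases (yes s≡u) (no t≢u) = begin
        (basis (src e) u - basis (tgt e) u) * (g (src e) - g (tgt e))
          ≈⟨ *-congʳ (+-cong (basis-≡ s≡u) (-‿cong (basis-≢ t≢u))) ⟩
        (1# - 0#) * (g (src e) - g (tgt e))
          ≈⟨ src-lemma (g (src e)) (g (tgt e)) ⟩
        g (src e) - g (tgt e)
          ≡⟨ ≡.cong (λ x → g x - g (tgt e)) s≡u ⟩
        g u - g (tgt e)
          ≈⟨ Σ-neighbour (λ v → indicator-⇔ (joins? e u v) (tgt e ≟ v)
               (λ { (inj₁ (_ , t≡v)) → t≡v ; (inj₂ (_ , t≡u)) → contradiction t≡u t≢u })
               (λ t≡v → inj₁ (s≡u , t≡v))) ⟨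
        sum (λ v → indicator (joins? e u v) * (g u - g v)) ∎
      by-cases (no s≢u) (yes t≡u) = begin
        (basis (src e) u - basis (tgt e) u) * (g (src e) - g (tgt e))
          ≈⟨ *-congʳ (+-cong (basis-≢ s≢u) (-‿cong (basis-≡ t≡u))) ⟩
        (0# - 1#) * (g (src e) - g (tgt e))
          ≈⟨ tgt-lemma (g (src e)) (g (tgt e)) ⟩
        g (tgt e) - g (src e)
          ≡⟨ ≡.cong (λ x → g x - g (src e)) t≡u ⟩
        g u - g (src e)
          ≈⟨ Σ-neighbour (λ v → indicator-⇔ (joins? e u v) (src e ≟ v)
               (λ { (inj₁ (s≡u , _)) → contradiction s≡u s≢u ; (inj₂ (s≡v , _)) → s≡v })
               (λ s≡v → inj₂ (s≡v , t≡u))) ⟨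
        sum (λ v → indicator (joins? e u v) * (g u - g v)) ∎
      by-cases (no s≢u) (no t≢u) = begin
        (basis (src e) u - basis (tgt e) u) * (g (src e) - g (tgt e))
          ≈⟨ *-congʳ (+-cong (basis-≢ s≢u) (-‿cong (basis-≢ t≢u))) ⟩
        (0# - 0#) * (g (src e) - g (tgt e))
          ≈⟨ other-lemma (g (src e)) (g (tgt e)) ⟩
        0#
          ≈⟨ sum-0 (λ v → trans (*-congʳ (reflexive (indicator-no (joins? e u v)
               λ { (inj₁ (s≡u , _)) → s≢u s≡u ; (inj₂ (_ , t≡u)) → t≢u t≡u })))
               (zeroˡ (g u - g v))) ⟨
        sum (λ v → indicator (joins? e u v) * (g u - g v)) ∎

    Joins-unique : ∀ (e f : Edge G) {u v} → Joins e u v → Joins f u v → e ≈ᵉ f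
    Joins-unique e f (inj₁ (a , b)) (inj₁ (c , d)) = inj₁ (≡.trans a (≡.sym c) , ≡.trans b (≡.sym d))
    Joins-unique e f (inj₁ (a , b)) (inj₂ (c , d)) = inj₂ (≡.trans a (≡.sym d) , ≡.trans b (≡.sym c))
    Joins-unique e f (inj₂ (a , b)) (inj₁ (c , d)) = inj₂ (≡.trans a (≡.sym d) , ≡.trans b (≡.sym c))
    Joins-unique e f (inj₂ (a , b)) (inj₂ (c , d)) = inj₁ (≡.trans a (≡.sym c) , ≡.trans b (≡.sym d))

    module _ (F : Fin p → Edge G) where

      private
        B = incidenceMatrix F

      incidenceᵀ-*ᵛ : ∀ g α → (B ᵀ *ᵛ g) α ≈ g (src (F α)) - g (tgt (F α))
      incidenceᵀ-*ᵛ g α = basis-difference-∙ (src (F α)) (tgt (F α)) g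

      -- Each column of `B` has sum zero, which makes `B *ᵛ ζ` an admissible right-hand side for
      -- `laplacian-solvable`.
      sum-incidence-*ᵛ : ∀ ζ → sum (B *ᵛ ζ) ≈ 0#
      sum-incidence-*ᵛ ζ = begin
        sum (B *ᵛ ζ)              ≈⟨ sum-cong-≋ (λ u → *-identityˡ ((B *ᵛ ζ) u)) ⟨
        (λ _ → 1#) ∙ (B *ᵛ ζ)     ≈⟨ ∙-*ᵛ B (λ _ → 1#) ζ ⟩
        (B ᵀ *ᵛ (λ _ → 1#)) ∙ ζ   ≈⟨ sum-0 (λ α → trans (*-congʳ (trans (incidenceᵀ-*ᵛ (λ _ → 1#) α) (-‿inverseʳ 1#))) (zeroˡ (ζ α))) ⟩
        0#                        ∎

      -- `B Bᵀ` is the Laplacian of the graph formed by the edges of `F`: the single-edge Laplacians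
      -- add up, and injectivity prevents any pair from being counted twice.
      incidence-incidenceᵀ : Injective _≡_ _≈ᵉ_ F → ∀ g u →
        (B *ᵛ (B ᵀ *ᵛ g)) u
          ≈ sum (λ v → indicator (any? λ α → joins? (F α) u v) * (g u - g v))
      incidence-incidenceᵀ F-inj g u = begin
        (B *ᵛ (B ᵀ *ᵛ g)) u
          ≈⟨ *ᵛ-cong B (incidenceᵀ-*ᵛ g) u ⟩
        (B *ᵛ (λ α → g (src (F α)) - g (tgt (F α)))) u
          ≈⟨ sum-cong-≋ (λ α → incidence-edge (F α) g u) ⟩
        sum (λ α → sum (λ v → indicator (joins? (F α) u v) * (g u - g v)))
          ≈⟨ ∑-comm {p} {n} (λ α v → indicator (joins? (F α) u v) * (g u - g v)) ⟩
        sum (λ v → sum (λ α → indicator (joins? (F α) u v) * (g u - g v)))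
          ≈⟨ sum-cong-≋ (λ v → *-distribʳ-sum (g u - g v) λ α → indicator (joins? (F α) u v)) ⟨
        sum (λ v → sum (λ α → indicator (joins? (F α) u v)) * (g u - g v))
          ≈⟨ sum-cong-≋ (λ v → *-congʳ (sum-indicator-unique (λ α → joins? (F α) u v)
               λ {α} {β} j k → F-inj (Joins-unique (F α) (F β) j k))) ⟩
        sum (λ v → indicator (any? λ α → joins? (F α) u v) * (g u - g v)) ∎

      edgeDefectMatrix-sym : Symmetricᴹ (edgeDefectMatrix F)
      edgeDefectMatrix-sym α β = ∙-comm ((B ᵀ) β) ((B ᵀ) α)

      shiftedDefect-*ᵛ : ∀ a ζ α → ((a *ₗ I -ᴹ edgeDefectMatrix F) *ᵛ ζ) α
                           ≈ a * ζ α - (B ᵀ *ᵛ (B *ᵛ ζ)) α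
      shiftedDefect-*ᵛ a ζ α = begin
        ((a *ₗ I -ᴹ Q) *ᵛ ζ) α
          ≈⟨ ∙-comm ((a *ₗ I -ᴹ Q) α) ζ ⟩
        ζ ∙ ((λ β → a * basis α β) -ᵛ Q α)
          ≈⟨ ∙-minus ζ (λ β → a * basis α β) (Q α) ⟩
        ζ ∙ (λ β → a * basis α β) - ζ ∙ Q α
          ≈⟨ +-cong (trans (∙-scale ζ a (basis α)) (*-congˡ (trans (∙-comm ζ (basis α)) (basis-∙ α ζ))))
               (-‿cong (trans (∙-comm ζ (Q α)) (*ᵛ-assoc (B ᵀ) B ζ α))) ⟩
        a * ζ α - (B ᵀ *ᵛ (B *ᵛ ζ)) α ∎
        where
        Q = edgeDefectMatrix F

      shiftedDefect-sym : ∀ a → Symmetricᴹ (a *ₗ I -ᴹ edgeDefectMatrix F)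
      shiftedDefect-sym a α β = +-cong
        (*-congˡ (reflexive (basis-sym β α)))
        (-‿cong (edgeDefectMatrix-sym α β))

  -- Deleting edges from the complete graph

  module _ (F : Fin p → Edge (complete n)) (F-inj : Injective _≡_ _≈ᵉ_ F) where

    private
      B = incidenceMatrix F
      G = complete n ─ F

    -- L(Kₙ - F) + B Bᵀ = L(Kₙ) = n I - J.
    laplacian+defect : ∀ g u → (B *ᵛ (B ᵀ *ᵛ g)) u + (laplacian G *ᵛ g) u
                         ≈ fromℕ n * g u - sum g
    laplacian+defect g u = begin
      (B *ᵛ (B ᵀ *ᵛ g)) u + (laplacian G *ᵛ g) u
        ≈⟨ +-cong (incidence-incidenceᵀ F F-inj g u) (laplacian-*ᵛ G g u) ⟩
      sum (λ v → deleted v * (g u - g v)) + sum (λ v → kept v * (g u - g v))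
        ≈⟨ ∑-distrib-+ (λ v → deleted v * (g u - g v)) (λ v → kept v * (g u - g v)) ⟨
      sum (λ v → deleted v * (g u - g v) + kept v * (g u - g v))
        ≈⟨ sum-cong-≋ (λ v → deleted-or-kept v (u ≟ v) (any? λ α → joins? (F α) u v)) ⟩
      sum (λ v → g u - g v)
        ≈⟨ sum-minus (λ _ → g u) g ⟩
      sum {n} (λ _ → g u) - sum g
        ≈⟨ +-congʳ (sum-const n (g u)) ⟩
      fromℕ n * g u - sum g ∎
      where
      open Graph G using (_~?_)

      deleted kept : Vector Carrier n
      deleted v = indicator (any? λ α → joins? (F α) u v)
      kept      = adjacencyMatrix G u

      loop : ∀ a b x → a * (x - x) + b * (x - x) ≈ x - x
      loop = solve 3 (λ a b x → a :* (x :- x) :+ b :* (x :- x) := x :- x) refl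

      left : ∀ x → 1# * x + 0# * x ≈ x
      left = solve 1 (λ x → :1 :* x :+ :0 :* x := x) refl

      right : ∀ x → 0# * x + 1# * x ≈ x
      right = solve 1 (λ x → :0 :* x :+ :1 :* x := x) refl

      deleted-or-kept : ∀ v → Dec (u ≡ v) → Dec (∃ λ α → Joins (F α) u v) →
        deleted v * (g u - g v) + kept v * (g u - g v) ≈ g u - g v
      -- For `v` equal to `u` every difference is zero, whatever the indicators are; otherwise
      -- exactly one of them is `1#`.
      deleted-or-kept v (yes ≡.refl) _ = loop (deleted u) (kept u) (g u)
      deleted-or-kept v (no u≢v) (yes j) = trans
        (+-cong (*-congʳ (reflexive (indicator-yes (any? λ α → joins? (F α) u v) j)))
                (*-congʳ (reflexive (indicator-no (u ~? v) λ (_ , ¬j) → ¬j j))))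
        (left (g u - g v))
      deleted-or-kept v (no u≢v) (no ¬j) = trans
        (+-cong (*-congʳ (reflexive (indicator-no (any? λ α → joins? (F α) u v) ¬j)))
                (*-congʳ (reflexive (indicator-yes (u ~? v) (u≢v , ¬j)))))
        (right (g u - g v))

    -- The identity `B Bᵀ = n I - J - L` applied to `w`, where `J w` vanishes because `w` has sum
    -- zero.
    defect-potential : {f w : Vector Carrier n} → (∀ u → (laplacian G *ᵛ w) u ≈ f u) → sum w ≈ 0# →
      ∀ u → (B *ᵛ (B ᵀ *ᵛ w)) u ≈ fromℕ n * w u - f u
    defect-potential {f} {w} Lw≈f Σw≈0 u = begin
      (B *ᵛ (B ᵀ *ᵛ w)) u                                        ≈⟨ cancel _ _ ⟨
      (B *ᵛ (B ᵀ *ᵛ w)) u + (laplacian G *ᵛ w) u - (laplacian G *ᵛ w) u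
        ≈⟨ +-cong (laplacian+defect w u) (-‿cong (Lw≈f u)) ⟩
      fromℕ n * w u - sum w - f u                                ≈⟨ +-congʳ (+-congˡ (-‿cong Σw≈0)) ⟩
      fromℕ n * w u - 0# - f u                                   ≈⟨ drop-0 _ _ ⟩
      fromℕ n * w u - f u                                        ∎
      where
      cancel : ∀ x y → x + y - y ≈ x
      cancel = solve 2 (λ x y → x :+ y :- y := x) refl

      drop-0 : ∀ x y → x - 0# - y ≈ x - y
      drop-0 = solve 2 (λ x y → x :- :0 :- y := x :- y) refl

    -- Bᵀ maps Laplacian potentials to solutions for n I - Q, because
    -- Q Bᵀ w = Bᵀ (B Bᵀ w) = Bᵀ (n w - f).
    shiftedDefect-potential : {f w : Vector Carrier n} → (∀ u → (laplacian G *ᵛ w) u ≈ f u) → sum w ≈ 0# →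
      ∀ α → ((fromℕ n *ₗ I -ᴹ edgeDefectMatrix F) *ᵛ (B ᵀ *ᵛ w)) α ≈ (B ᵀ *ᵛ f) α
    shiftedDefect-potential {f} {w} Lw≈f Σw≈0 α = begin
      ((fromℕ n *ₗ I -ᴹ edgeDefectMatrix F) *ᵛ (B ᵀ *ᵛ w)) α
        ≈⟨ shiftedDefect-*ᵛ F (fromℕ n) (B ᵀ *ᵛ w) α ⟩
      fromℕ n * (B ᵀ *ᵛ w) α - (B ᵀ *ᵛ (B *ᵛ (B ᵀ *ᵛ w))) α
        ≈⟨ +-congˡ (-‿cong (*ᵛ-cong (B ᵀ) (defect-potential {f} {w} Lw≈f Σw≈0) α)) ⟩
      fromℕ n * (B ᵀ *ᵛ w) α - (B ᵀ *ᵛ (λ u → fromℕ n * w u - f u)) α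
        ≈⟨ +-congˡ (-‿cong (trans (∙-minus ((B ᵀ) α) (λ u → fromℕ n * w u) f)
             (+-congʳ (∙-scale ((B ᵀ) α) (fromℕ n) w)))) ⟩
      fromℕ n * (B ᵀ *ᵛ w) α - (fromℕ n * (B ᵀ *ᵛ w) α - (B ᵀ *ᵛ f) α)
        ≈⟨ lemma _ _ ⟩
      (B ᵀ *ᵛ f) α ∎
      where
      lemma : ∀ x y → x - (x - y) ≈ y
      lemma = solve 2 (λ x y → x :- (x :- y) := y) refl

    -- Invertibility of `n I - Q` and the resistance formula.

    module _ .{{_ : NonZero n}} (connected : Graph.Connected G) where

      shiftedDefect-invertible : Invertible (fromℕ n *ₗ I -ᴹ edgeDefectMatrix F)
      shiftedDefect-invertible = symmetric-solvable⇒invertible M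
        (shiftedDefect-sym F (fromℕ n)) solution
        where
        M : Matrix p p
        M = fromℕ n *ₗ I -ᴹ edgeDefectMatrix F

        -- Woodbury: (n I - Q)⁻¹ = (I + Bᵀ L⁺ B) / n.
        solution : ∀ η → ∃ λ ζ → ∀ α → (M *ᵛ ζ) α ≈ η α
        solution η = ζ , λ α → begin
          (M *ᵛ ζ) α
            ≈⟨ ∙-scale (M α) (1/ n) (λ β → η β + (B ᵀ *ᵛ w) β) ⟩
          1/ n * (M *ᵛ (λ β → η β + (B ᵀ *ᵛ w) β)) α
            ≈⟨ *-congˡ (∙-plus (M α) η (B ᵀ *ᵛ w)) ⟩
          1/ n * ((M *ᵛ η) α + (M *ᵛ (B ᵀ *ᵛ w)) α)
            ≈⟨ *-congˡ (+-cong (shiftedDefect-*ᵛ F (fromℕ n) η α)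
                 (shiftedDefect-potential (proj₁ (proj₂ potential)) (proj₂ (proj₂ potential)) α)) ⟩
          1/ n * (fromℕ n * η α - (B ᵀ *ᵛ (B *ᵛ η)) α + (B ᵀ *ᵛ (B *ᵛ η)) α)
            ≈⟨ lemma (1/ n) (fromℕ n) (η α) _ ⟩
          fromℕ n * (1/ n * η α)
            ≈⟨ fromℕ-1/-* n (η α) ⟩
          η α ∎
          where
          -- `M η` equals `n η - Bᵀ B η`. With `L w = B η`, `shiftedDefect-potential` gives
          -- `M Bᵀ w = Bᵀ B η`, exactly the missing term.
          potential = laplacian-solvable G connected (B *ᵛ η) (sum-incidence-*ᵛ F η)

          w : Vector Carrier n
          w = proj₁ potential

          ζ : Vector Carrier p
          ζ α = 1/ n * (η α + (B ᵀ *ᵛ w) α)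

          lemma : ∀ r m x y → r * (m * x - y + y) ≈ m * (r * x)
          lemma = solve 4 (λ r m x y → r :* (m :* x :- y :+ y) := m :* (r :* x)) refl

      resistance-formula : ∀ x y → x ≢ y →
        (L⁺ : MoorePenroseInverse (laplacian G))
        (N : Invertible (fromℕ n *ₗ I -ᴹ edgeDefectMatrix F)) →
        let η = B ᵀ *ᵛ (basis x -ᵛ basis y) in
        effectiveResistance G L⁺ x y
          ≈ 2 /ᴺ n + 1/ n * (η ∙ (inverse N *ᵛ η))
      resistance-formula x y x≢y L⁺ N = begin
        z ∙ (A⁺ *ᵛ z)                          ≈⟨ resistance ⟩
        z ∙ w                                  ≈⟨ fromℕ-cancel n scaled ⟩
        2 /ᴺ n + 1/ n * (η ∙ (inverse N *ᵛ η)) ∎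
        where
        open MoorePenroseInverse L⁺ using (A⁺; AA⁺A≈A)

        L : Matrix n n
        L = laplacian G

        M : Matrix p p
        M = fromℕ n *ₗ I -ᴹ edgeDefectMatrix F

        z : Vector Carrier n
        z = basis x -ᵛ basis y

        η : Vector Carrier p
        η = B ᵀ *ᵛ z

        Σz≈0 : sum z ≈ 0#
        Σz≈0 = trans (sum-minus (basis x) (basis y))
          (trans (+-cong (sum-basis x) (-‿cong (sum-basis y))) (-‿inverseʳ 1#))

        potential = laplacian-solvable G connected z Σz≈0

        w : Vector Carrier n
        w = proj₁ potential

        Lw≈z : ∀ u → (L *ᵛ w) u ≈ z u
        Lw≈z = proj₁ (proj₂ potential)

        Σw≈0 : sum w ≈ 0#
        Σw≈0 = proj₂ (proj₂ potential)

        z∙z≈2 : z ∙ z ≈ fromℕ 2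
        z∙z≈2 = begin
          z ∙ z          ≈⟨ basis-difference-∙ x y z ⟩
          (basis x x - basis y x) - (basis x y - basis y y)
            ≈⟨ +-cong (+-cong (yes-entry x) (-‿cong (no-entry (x≢y ∘ ≡.sym))))
                 (-‿cong (+-cong (no-entry x≢y) (-‿cong (yes-entry y)))) ⟩
          -- `fromℕ 2` unfolds to `1# + (1# + 0#)`.
          (1# - 0#) - (0# - 1#)  ≈⟨ solve 0 ((:1 :- :0) :- (:0 :- :1) := :1 :+ (:1 :+ :0)) refl ⟩
          fromℕ 2        ∎
          where
          yes-entry : ∀ v → basis v v ≈ 1#
          yes-entry v = reflexive (indicator-yes (v ≟ v) ≡.refl)

          no-entry : ∀ {u v} → u ≢ v → basis u v ≈ 0#
          no-entry {u} {v} u≢v = reflexive (indicator-no (u ≟ v) u≢v)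

        resistance : z ∙ (A⁺ *ᵛ z) ≈ z ∙ w
        resistance = begin
          z ∙ (A⁺ *ᵛ z)                ≈⟨ ∙-cong Lw≈z (*ᵛ-cong A⁺ Lw≈z) ⟨
          (L *ᵛ w) ∙ (A⁺ *ᵛ (L *ᵛ w))  ≈⟨ ∙-*ᵛ-symmetric L (laplacian-sym G) w _ ⟨
          w ∙ (L *ᵛ (A⁺ *ᵛ (L *ᵛ w)))  ≈⟨ ∙-cong (λ _ → refl) (*ᵛ-assoc L A⁺ (L *ᵛ w)) ⟨
          w ∙ ((L *ᴹ A⁺) *ᵛ (L *ᵛ w))  ≈⟨ ∙-cong (λ _ → refl) (*ᵛ-assoc (L *ᴹ A⁺) L w) ⟨
          w ∙ ((L *ᴹ A⁺ *ᴹ L) *ᵛ w)    ≈⟨ ∙-cong (λ _ → refl) (λ u → ∙-cong (AA⁺A≈A u) (λ _ → refl)) ⟩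
          w ∙ (L *ᵛ w)                 ≈⟨ ∙-cong (λ _ → refl) Lw≈z ⟩
          w ∙ z                        ≈⟨ ∙-comm w z ⟩
          z ∙ w                        ∎

        N⁻¹η : ∀ α → (inverse N *ᵛ η) α ≈ (B ᵀ *ᵛ w) α
        N⁻¹η α = begin
          -- Since `M Bᵀ w = η`, the left inverse law recovers `Bᵀ w`.
          (inverse N *ᵛ η) α                   ≈⟨ *ᵛ-cong (inverse N) (shiftedDefect-potential {z} {w} Lw≈z Σw≈0) α ⟨
          (inverse N *ᵛ (M *ᵛ (B ᵀ *ᵛ w))) α   ≈⟨ *ᵛ-assoc (inverse N) M (B ᵀ *ᵛ w) α ⟨
          ((inverse N *ᴹ M) *ᵛ (B ᵀ *ᵛ w)) α   ≈⟨ ∙-cong (proj₁ (proj₂ N) α) (λ _ → refl) ⟩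
          basis α ∙ (B ᵀ *ᵛ w)                 ≈⟨ basis-∙ α (B ᵀ *ᵛ w) ⟩
          (B ᵀ *ᵛ w) α                         ∎

        quadratic-form : η ∙ (inverse N *ᵛ η) ≈ fromℕ n * (z ∙ w) - fromℕ 2
        quadratic-form = begin
          η ∙ (inverse N *ᵛ η)                ≈⟨ ∙-cong (λ _ → refl) N⁻¹η ⟩
          (B ᵀ *ᵛ z) ∙ (B ᵀ *ᵛ w)             ≈⟨ ∙-*ᵛ B z (B ᵀ *ᵛ w) ⟨
          z ∙ (B *ᵛ (B ᵀ *ᵛ w))               ≈⟨ ∙-cong (λ _ → refl) (defect-potential {z} {w} Lw≈z Σw≈0) ⟩
          z ∙ (λ u → fromℕ n * w u - z u)     ≈⟨ ∙-minus z (λ u → fromℕ n * w u) z ⟩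
          z ∙ (λ u → fromℕ n * w u) - z ∙ z   ≈⟨ +-cong (∙-scale z (fromℕ n) w) (-‿cong z∙z≈2) ⟩
          fromℕ n * (z ∙ w) - fromℕ 2         ∎

        scaled : fromℕ n * (z ∙ w)
          ≈ fromℕ n * (2 /ᴺ n + 1/ n * (η ∙ (inverse N *ᵛ η)))
        scaled = sym (begin
          fromℕ n * (fromℕ 2 * 1/ n + 1/ n * (η ∙ (inverse N *ᵛ η)))
            ≈⟨ factor (fromℕ n) (fromℕ 2) (1/ n) _ ⟩
          fromℕ n * (1/ n * (fromℕ 2 + η ∙ (inverse N *ᵛ η)))
            ≈⟨ fromℕ-1/-* n _ ⟩
          fromℕ 2 + η ∙ (inverse N *ᵛ η)
            ≈⟨ +-congˡ quadratic-form ⟩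
          fromℕ 2 + (fromℕ n * (z ∙ w) - fromℕ 2)
            ≈⟨ cancel (fromℕ 2) _ ⟩
          fromℕ n * (z ∙ w) ∎)
          where
          factor : ∀ m t r q → m * (t * r + r * q) ≈ m * (r * (t + q))
          factor = solve 4 (λ m t r q → m :* (t :* r :+ r :* q) := m :* (r :* (t :+ q))) refl

          cancel : ∀ t x → t + (x - t) ≈ x
          cancel = solve 2 (λ t x → t :+ (x :- t) := x) refl

theorem3p1 :
  ∀ {c ℓ₁ ℓ₂} (K : HeytingField c ℓ₁ ℓ₂) (char0 : CharacteristicZero K) →
  (n p : ℕ) .{{_ : NonZero n}} → 1 ≤ p →
  (F : Fin p → Edge (complete n)) → Injective _≡_ _≈ᵉ_ F →
  Graph.Connected (complete n ─ F) →
  (x y : Fin n) → x ≢ y →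
  let open Field K char0
      G = complete n ─ F
      B = incidenceMatrix F
      Q = edgeDefectMatrix F
      η = B ᵀ *ᵛ (basis x -ᵛ basis y)
  in
  MoorePenroseInverse (laplacian G) ×
  Invertible (fromℕ n *ₗ I -ᴹ Q) ×
  ((L⁺ : MoorePenroseInverse (laplacian G))
   (N : Invertible (fromℕ n *ₗ I -ᴹ Q)) →
   effectiveResistance G L⁺ x y
     ≈ 2 /ᴺ n + (1/ n) * (η ∙ (inverse N *ᵛ η)))
-- The first two components ensure that the formula, stated for every `L⁺` and `N`, is not vacuous.
theorem3p1 K char0 n p 1≤p F F-inj connected x y x≢y =
  laplacian-MoorePenroseInverse (complete n ─ F) connected ,
  shiftedDefect-invertible F F-inj connected ,
  resistance-formula F F-inj connected x y x≢y
  where open LinearAlgebra K char0
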